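{- Consider the routing protocol described in the context, in the case where every filtering list is empty, i.e. $\mathcal{D}(v)=\emptyset$ for all $v\in V$. Then for every network and every initial configuration there is a choice of four permutations $\pi_1,\pi_2,\pi_3,\pi_4$ of $V\setminus\{r\}$ such that, in four rounds, every packet reaches the sink $r$ (regardless of how packets stuck on cycles are repositioned). In particular this holds even when the network admits no equilibrium.
   Context: A network is a directed graph $G=(V,A)$ on $n$ nodes with a sink node $r$ that has no outgoing arc, such that every node has a directed path to $r$ in $G$. Each node $v\neq r$ has a strict ranking of its out-neighbours (next-hop preferences) and a filtering list $\mathcal{D}(v)\subseteq V$. At any time each node $v\ne r$ has a routing path $\mathcal{P}(v)$, which is either $\emptyset$ or a directed $v,r$-path, and selects at most one outgoing arc; the selected arcs form the routing graph. A node $w$ is clear if $\mathcal{P}(w)\neq\emptyset$. A node $w$ is valid for $v$ if $(v,w)\in A$, $w$ is clear, and $\mathcal{P}(w)$ contains no node of $\mathcal{D}(v)$; the best valid choice of $v$ is its highest-ranked valid out-neighbour. Activating $v$: if $v$ has a valid choice, $v$ selects the arc $(v,w)$ to its best valid choice $w$ and sets $\mathcal{P}(v)$ to $v$ followed by $\mathcal{P}(w)$ (using the current value of $\mathcal{P}(w)$); otherwise $v$ sets $\mathcal{P}(v):=\emptyset$ and selects no arc. Protocol: start from an arbitrary initial routing graph and arbitrary initial routing paths; initially every node generates one packet. In each round $t=1,2,\dots$, a permutation $\pi_t$ of $V\setminus\{r\}$ is chosen (so each node is activated exactly once per round); (control plane) the nodes are activated one at a time in the order $\pi_t$, producing routing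 graph $\mathcal{R}_t$; (forwarding plane) every packet is forwarded along arcs of $\mathcal{R}_t$ (a packet at $v$ moves to the head of $v$'s selected arc) until it reaches $r$ or has moved $n$ hops; (route verification) every node $v$ sets $\mathcal{P}(v)$ to its $v,r$-path in $\mathcal{R}_t$ if one exists and to $\emptyset$ otherwise. A packet stuck on a cycle may be placed by an adversary at any node of that cycle at the start of the next round. A packet routes once it reaches $r$. -}

module Defs where

open import Data.Nat using (ℕ; zero; suc)
open import Data.Fin using (Fin; _≟_)
open import Data.Bool using (Bool; true; false; if_then_else_; _∨_)
open import Data.List using (List; []; _∷_)
open import Data.Bool.ListAction using (any)
open import Data.Empty using (⊥)
open import Data.List.Membership.Propositional using (_∈_; _∉_)
open import Data.List.Relation.Unary.Unique.Propositional using (Unique)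
open import Data.Maybe using (Maybe; just; nothing; map)
open import Data.Product using (_×_; _,_; ∃; ∃-syntax)
open import Data.Sum using (_⊎_)
open import Relation.Nullary using (¬_)
open import Relation.Nullary.Decidable using (⌊_⌋)
open import Relation.Binary.PropositionalEquality using (_≡_; _≢_)

-- Networks.  Nodes are Fin n.  The arc set and each node's strict
-- ranking of its out-neighbours are encoded together by a duplicate-free
-- preference list: (v , w) ∈ A  iff  w ∈ pref v, and earlier in the list
-- means higher ranked.

data ReachesSink {n : ℕ} (s : Fin n) (pref : Fin n → List (Fin n)) : Fin n → Set where
  atSink : ReachesSink s pref s
  viaArc : ∀ {v w} → w ∈ pref v → ReachesSink s pref w → ReachesSink s pref v

record Network (n : ℕ) : Set where
  field
    sink       : Fin n
    pref       : Fin n → List (Fin n)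
    prefUnique : ∀ v → Unique (pref v)
    noLoop     : ∀ v → v ∉ pref v
    sinkNoOut  : pref sink ≡ []
    reach      : ∀ v → ReachesSink sink pref v

-- a selection of at most one outgoing arc per node (the routing graph)
Sel : ℕ → Set
Sel n = Fin n → Maybe (Fin n)

-- routing paths: nothing = ∅, just p = the node sequence p
Paths : ℕ → Set
Paths n = Fin n → Maybe (List (Fin n))

record Config (n : ℕ) : Set where
  constructor config
  field
    sel   : Sel n
    paths : Paths n

module _ {n : ℕ} (N : Network n) where
  open Network N

  data DirWalk : Fin n → List (Fin n) → Set where
    end  : DirWalk sink (sink ∷ [])
    cons : ∀ {v w p} → w ∈ pref v → DirWalk w p → DirWalk v (v ∷ p)

  IsDirPath : Fin n → List (Fin n) → Set
  IsDirPath v p = DirWalk v p × Unique p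

  ValidConfig : Config n → Set
  ValidConfig c =
    (∀ v w → Config.sel c v ≡ just w → w ∈ pref v) ×
    (∀ v → v ≢ sink → Config.paths c v ≡ nothing
                      ⊎ ∃[ p ] (Config.paths c v ≡ just p × IsDirPath v p))

  IsOrder : List (Fin n) → Set
  IsOrder π = Unique π × sink ∉ π × (∀ v → v ≢ sink → v ∈ π)

  upd : {A : Set} → (Fin n → A) → Fin n → A → Fin n → A
  upd f v a u = if ⌊ u ≟ v ⌋ then a else f u

  -- the sink is always clear with routing path (r)
  eff : Paths n → Fin n → Maybe (List (Fin n))
  eff P w = if ⌊ w ≟ sink ⌋ then just (sink ∷ []) else P w

  elem : Fin n → List (Fin n) → Bool
  elem x xs = any (λ y → ⌊ x ≟ y ⌋) xs

  module _ (D : Fin n → List (Fin n)) where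

    best : Paths n → Fin n → List (Fin n) → Maybe (Fin n × List (Fin n))
    best P v [] = nothing
    best P v (w ∷ ws) with eff P w
    ... | nothing = best P v ws
    ... | just p  = if any (λ x → elem x (D v)) p then best P v ws else just (w , p)

    activate : Config n → Fin n → Config n
    activate (config s P) v with best P v (pref v)
    ... | nothing       = config (upd s v nothing) (upd P v nothing)
    ... | just (w , p)  = config (upd s v (just w)) (upd P v (just (v ∷ p)))

    controlPlane : Config n → List (Fin n) → Config n
    controlPlane c []       = c
    controlPlane c (v ∷ π)  = controlPlane (activate c v) π

    -- the v,r-path in routing graph R, if any (such a path has < n hops,
    -- so n units of fuel suffice)
    pathIn : Sel n → ℕ → Fin n → Maybe (List (Fin n))
    pathIn R zero v = nothing
    pathIn R (suc k) v with ⌊ v ≟ sink ⌋ | R v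
    ... | true  | _       = just (sink ∷ [])
    ... | false | nothing = nothing
    ... | false | just w  = map (v ∷_) (pathIn R k w)

    round : Config n → List (Fin n) → Sel n × Config n
    round c π = let R = Config.sel (controlPlane c π)
                in R , config R (λ v → pathIn R n v)

    routingGraphs : Config n → List (List (Fin n)) → List (Sel n)
    routingGraphs c []        = []
    routingGraphs c (π ∷ πs)  with round c π
    ... | R , c' = R ∷ routingGraphs c' πs

  hop : Sel n → Fin n → Fin n
  hop R u with ⌊ u ≟ sink ⌋ | R u
  ... | true  | _       = u
  ... | false | nothing = u
  ... | false | just w  = w

  hops : Sel n → ℕ → Fin n → Fin n
  hops R zero    u = u
  hops R (suc k) u = hops R k (hop R u)

  -- position of a packet starting at u after forwarding in R
  -- (until it reaches r or has moved n hops)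
  forward : Sel n → Fin n → Fin n
  forward R u = hops R n u

  -- y lies on the same cycle of R as x (or y = x): the adversary may
  -- move a packet left at x to any such y
  CycleMate : Sel n → Fin n → Fin n → Set
  CycleMate R x y = ∃[ k ] (hops R k x ≡ y) × ∃[ m ] (hops R m y ≡ x)

  AlwaysRoutes : List (Sel n) → Fin n → Set
  AlwaysRoutes []       u = ⊥
  AlwaysRoutes (R ∷ Rs) u =
    forward R u ≡ sink ⊎ (∀ y → CycleMate R (forward R u) y → AlwaysRoutes Rs y)

{-# OPTIONS --safe #-}
module Submission where

-- Let T be the set of nodes that reach the sink by first choices; in every round T is activated first.
-- In rounds 1 and 2, next activate (phase A) any node whose best clear choice lies outside T, and when
-- there is none left (phase B) the unclear nodes, then the rest. The set W of phase-B nodes is closed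
-- under first choices and W is routed to the sink through T ∪ W.
--  * After round 1, every clear node outside T has its best clear choice outside T.
--  * Hence in round 2 phase A contains all clear nodes outside T and sends none of them to the sink, so
--    exactly T ∪ W is clear after round 2. Each node of W chose T or an earlier node of W although
--    everything outside the rest of W was clear.
--  * In round 3, W therefore follows first choices and is a trap; all other nodes lead into T or W.
--  * In round 4, W starts unclear, so by the previous remark it can repeat its moves of round 2,
--    whatever else is clear, and it now reaches the sink.
-- Thus packets not routed in round 3 sit in W, and those are routed in round 4.

open import Defs
open import Data.Nat using (ℕ; zero; suc; _+_; _≤_; z≤n; s≤s)
open import Data.Nat.Properties using (≤-refl; ≤-trans; ≤-reflexive; n≤1+n; 1+n≰n; +-identityʳ; +-suc; m≤n+m)
open import Data.Fin using (Fin; zero; suc; _≟_)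
open import Data.Fin.Properties using (any?; injective⇒≤)
open import Data.Bool using (false)
open import Data.Bool.ListAction using (any)
open import Data.List using (List; []; _∷_; _++_; length; lookup; reverse)
open import Data.List.Properties using (unfold-reverse)
open import Data.List.Membership.Propositional using (_∈_; _∉_)
open import Data.List.Membership.Propositional.Properties using (∈-lookup)
open import Data.List.Relation.Unary.All using (All; []; _∷_)
import Data.List.Relation.Unary.All as All
open import Data.List.Relation.Unary.All.Properties using (¬Any⇒All¬)
open import Data.List.Relation.Unary.AllPairs using ([]; _∷_)
open import Data.List.Relation.Unary.Any using (here; there)
import Data.List.Relation.Unary.Any.Properties as Any
open import Data.List.Relation.Unary.Unique.Propositional using (Unique)
import Data.List.Relation.Binary.Permutation.Setoid.Properties as Permutation
import Data.List.Relation.Binary.Permutation.Setoid as PermutationBase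
open import Data.Maybe using (just; nothing)
open import Data.Maybe.Properties using (just-injective)
open import Data.Product using (_×_; _,_; ∃-syntax; proj₁; proj₂)
open import Data.Sum using (_⊎_; inj₁; inj₂; [_,_]′)
open import Data.Unit using (⊤; tt)
open import Function using (_∘_; id; case_of_)
open import Relation.Nullary using (¬_; Dec; yes; no; ¬?; _×-dec_; _⊎-dec_; contradiction)
open import Relation.Nullary.Decidable using (map′; decidable-stable)
open import Relation.Unary using (Pred; Decidable; U)
open import Relation.Binary.PropositionalEquality
  using (_≡_; _≢_; refl; sym; trans; cong; subst; setoid)
open import Level using (0ℓ)

-- Duplicate-free lists of nodes

lookup-injective : ∀ {A : Set} {xs : List A} → Unique xs →
  ∀ {i j} → lookup xs i ≡ lookup xs j → i ≡ j
lookup-injective (_ ∷ _)  {zero}  {zero}  _  = refl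
lookup-injective (x≢ ∷ _) {zero}  {suc j} eq = contradiction eq (All.lookup x≢ (∈-lookup j))
lookup-injective (x≢ ∷ _) {suc i} {zero}  eq = contradiction (sym eq) (All.lookup x≢ (∈-lookup i))
lookup-injective (_ ∷ u)  {suc i} {suc j} eq = cong suc (lookup-injective u eq)

unique⇒length≤ : ∀ {n} {xs : List (Fin n)} → Unique xs → length xs ≤ n
unique⇒length≤ u = injective⇒≤ (lookup-injective u)

unique-∷ : ∀ {A : Set} {x : A} {xs} → x ∉ xs → Unique xs → Unique (x ∷ xs)
unique-∷ x∉xs u = ¬Any⇒All¬ _ x∉xs ∷ u

unique-reverse : ∀ {A : Set} {xs : List A} → Unique xs → Unique (reverse xs)
unique-reverse {A} {xs} = Unique-resp-↭ (↭-sym (↭-reverse xs))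
  where
  open Permutation (setoid A)
  open PermutationBase (setoid A)

-- Best elements of a preference list

data Best {A : Set} (K : Pred A 0ℓ) : List A → A → Set where
  here  : ∀ {w ws} → K w → Best K (w ∷ ws) w
  there : ∀ {x w ws} → ¬ K x → Best K ws w → Best K (x ∷ ws) w

module _ {A : Set} where

  private variable
    K L P : Pred A 0ℓ
    ws : List A
    w w′ : A

  best-holds : Best K ws w → K w
  best-holds (here k)    = k
  best-holds (there _ b) = best-holds b

  best-∈ : Best K ws w → w ∈ ws
  best-∈ (here _)    = here refl
  best-∈ (there _ b) = there (best-∈ b)

  -- Whichever of `w` and `w′` comes first satisfies both predicates, so neither search can pass
  -- over it. This compares choices made under different clear sets.
  best-cross : Best K ws w → Best L ws w′ → K w′ → L w → w ≡ w′
  best-cross (here _)     (here _)     _  _ = refl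
  best-cross (here _)     (there ¬l _) _  l = contradiction l ¬l
  best-cross (there ¬k _) (here _)     k  _ = contradiction k ¬k
  best-cross (there _ b)  (there _ b′) k  l = best-cross b b′ k l

  best-restrict : (∀ u → L u → K u) → Best K ws w → L w → Best L ws w
  best-restrict L⊆K (here _)     l = here l
  best-restrict L⊆K (there ¬k b) l = there (¬k ∘ L⊆K _) (best-restrict L⊆K b l)

  best-exists : Decidable K → w ∈ ws → K w → ∃[ v ] Best K ws v
  best-exists {ws = x ∷ _} K? w∈ kw with K? x
  ... | yes kx = x , here kx
  best-exists K? (here refl) kw | no ¬kx = contradiction kw ¬kx
  best-exists K? (there w∈)  kw | no ¬kx with best-exists K? w∈ kw
  ... | v , b = v , there ¬kx b

  best-dec : Decidable K → Decidable P → ∀ ws → Dec (∃[ w ] (Best K ws w × P w))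
  best-dec K? P? []       = no λ ()
  best-dec K? P? (x ∷ ws) with K? x
  ... | yes kx = map′ (λ p → x , here kx , p)
                      (λ { (_ , here _ , p) → p ; (_ , there ¬k _ , _) → contradiction kx ¬k })
                      (P? x)
  ... | no ¬kx = map′ (λ { (w , b , p) → w , there ¬kx b , p })
                      (λ { (_ , here k , _) → contradiction k ¬kx ; (w , there _ b , p) → w , b , p })
                      (best-dec K? P? ws)

-- Activation sequences

-- Lists of activated nodes have the most recent activation at the head.
data Suffix {A : Set} (xs : List A) : List A → Set where
  here  : Suffix xs xs
  there : ∀ {y ys} → Suffix xs ys → Suffix xs (y ∷ ys)

data Steps {A : Set} (Q : List A → Pred A 0ℓ) (ρ : List A) : List A → Set where
  []   : Steps Q ρ ρ
  step : ∀ {σ v} → Steps Q ρ σ → v ∉ σ → Q σ v → Steps Q ρ (v ∷ σ)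

module _ {A : Set} where

  private variable
    Q Q′ : List A → Pred A 0ℓ
    ρ σ θ : List A
    x : A

  suffix-trans : Suffix ρ σ → Suffix σ θ → Suffix ρ θ
  suffix-trans s here      = s
  suffix-trans s (there t) = there (suffix-trans s t)

  suffix-tail : Suffix (x ∷ ρ) σ → Suffix ρ σ
  suffix-tail = suffix-trans (there here)

  suffix-∈ : Suffix ρ σ → x ∈ ρ → x ∈ σ
  suffix-∈ here      x∈ = x∈
  suffix-∈ (there s) x∈ = there (suffix-∈ s x∈)

  steps-suffix : Steps Q ρ σ → Suffix ρ σ
  steps-suffix []           = here
  steps-suffix (step s _ _) = there (steps-suffix s)

  suffix-length : Suffix ρ σ → length ρ ≤ length σ
  suffix-length here      = ≤-refl
  suffix-length (there s) = ≤-trans (suffix-length s) (n≤1+n _)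

  suffix-∈⁻ : x ∈ σ → ∃[ ρ ] Suffix (x ∷ ρ) σ
  suffix-∈⁻ (here refl) = _ , here
  suffix-∈⁻ (there x∈) with suffix-∈⁻ x∈
  ... | ρ , s = ρ , there s

  steps-map : (∀ {σ v} → Q σ v → Q′ σ v) → Steps Q ρ σ → Steps Q′ ρ σ
  steps-map f []            = []
  steps-map f (step s v∉ q) = step (steps-map f s) v∉ (f q)

  steps-trans : Steps Q ρ σ → Steps Q σ θ → Steps Q ρ θ
  steps-trans s []            = s
  steps-trans s (step t v∉ q) = step (steps-trans s t) v∉ q

  steps-∈ : Steps Q ρ σ → x ∈ σ →
    x ∈ ρ ⊎ ∃[ θ ] (Suffix ρ θ × Suffix (x ∷ θ) σ × x ∉ θ × Q θ x)
  steps-∈ [] x∈ = inj₁ x∈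
  steps-∈ (step s v∉ q) (here refl) = inj₂ (_ , steps-suffix s , here , v∉ , q)
  steps-∈ (step s v∉ q) (there x∈) with steps-∈ s x∈
  ... | inj₁ x∈ρ = inj₁ x∈ρ
  ... | inj₂ (θ , ρθ , θσ , x∉ , qx) = inj₂ (θ , ρθ , there θσ , x∉ , qx)

  steps-unique : Steps Q ρ σ → Unique ρ → Unique σ
  steps-unique []            u = u
  steps-unique (step s v∉ q) u = unique-∷ v∉ (steps-unique s u)

module _ {n : ℕ} where
  open import Data.List.Membership.DecPropositional (_≟_ {n}) using (_∈?_; _∉?_) public

  -- Greedy extension stops because a duplicate-free list has at most `n` entries; the fuel `k`
  -- bounds the extensions still possible.
  saturate : {Q : List (Fin n) → Pred (Fin n) 0ℓ} → (∀ σ → Decidable (Q σ)) →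
    ∀ {ρ} → Unique ρ → ∃[ σ ] (Steps Q ρ σ × ∀ v → v ∉ σ → ¬ Q σ v)
  saturate {Q} Q? {ρ} = go n ρ (m≤n+m n (length ρ))
    where
    go : ∀ k ρ → n ≤ length ρ + k → Unique ρ → ∃[ σ ] (Steps Q ρ σ × ∀ v → v ∉ σ → ¬ Q σ v)
    go k ρ bound u with any? (λ v → (v ∉? ρ) ×-dec Q? ρ v)
    ... | no ¬q = ρ , [] , λ v v∉ q → ¬q (v , v∉ , q)
    go zero ρ bound u | yes (v , v∉ , q) =
      contradiction (≤-trans (unique⇒length≤ (unique-∷ v∉ u)) (≤-trans bound (≤-reflexive (+-identityʳ _))))
                    1+n≰n
    go (suc k) ρ bound u | yes (v , v∉ , q)
      with go k (v ∷ ρ) (≤-trans bound (≤-reflexive (+-suc _ k))) (unique-∷ v∉ u)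
    ... | σ , s , stuck = σ , steps-trans (step [] v∉ q) s , stuck

-- Routing graphs and abstract executions

module _ {n : ℕ} (N : Network n) where
  open Network N

  -- Reach R L k v: at most k - 1 arcs of R lead from v into L, so that Reach R (_≡ sink) k
  -- holds exactly where pathIn with fuel k finds a path.
  data Reach (R : Sel n) (L : Pred (Fin n) 0ℓ) : ℕ → Fin n → Set where
    done : ∀ {k v} → L v → Reach R L (suc k) v
    via  : ∀ {k v w} → v ≢ sink → R v ≡ just w → Reach R L k w → Reach R L (suc k) v

  AtSink : Pred (Fin n) 0ℓ
  AtSink v = v ≡ sink

  -- The clear nodes after the activations ρ when C was clear before: in every order used below,
  -- each activated node finds a valid choice, so that nodes only become clear.
  K : Pred (Fin n) 0ℓ → List (Fin n) → Pred (Fin n) 0ℓ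
  K C ρ u = C u ⊎ u ∈ ρ

  -- `P` restricts the target: `U` admits every clear target, and phase A uses the complement of the
  -- core.
  Move : Pred (Fin n) 0ℓ → Pred (Fin n) 0ℓ → List (Fin n) → Pred (Fin n) 0ℓ
  Move C P ρ v = v ≢ sink × ∃[ w ] (Best (K C ρ) (pref v) w × P w)

  sink∷⊆K : ∀ {C ρ} → C sink → ∀ {w} → w ∈ sink ∷ ρ → K C ρ w
  sink∷⊆K csink (here refl) = inj₁ csink
  sink∷⊆K csink (there w∈)  = inj₂ w∈

  Exec : Pred (Fin n) 0ℓ → List (Fin n) → Set
  Exec C = Steps (Move C U) []

  -- Each node moves at most once, so the arc selected at its turn is still its arc at the end of
  -- the round.
  Realizes : Pred (Fin n) 0ℓ → List (Fin n) → Sel n → Set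
  Realizes C ρ R = ∀ {v σ} → Suffix (v ∷ σ) ρ → ∃[ w ] (R v ≡ just w × Best (K C σ) (pref v) w)

  Clear : Paths n → Pred (Fin n) 0ℓ
  Clear P u = ∃[ p ] eff N P u ≡ just p

  clear? : ∀ P → Decidable (Clear P)
  clear? P u with eff N P u
  ... | just p  = yes (p , refl)
  ... | nothing = no λ ()

  clear-sink : ∀ P → Clear P sink
  clear-sink P with sink ≟ sink
  ... | yes _ = _ , refl
  ... | no ≢  = contradiction refl ≢

  hop-sink : ∀ R {v} → v ≡ sink → hop N R v ≡ v
  hop-sink R {v} v≡ with v ≟ sink | R v
  ... | yes _ | _ = refl
  ... | no ≢  | _ = contradiction v≡ ≢

  hop-arc : ∀ R {v w} → v ≢ sink → R v ≡ just w → hop N R v ≡ w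
  hop-arc R {v} v≢ eq with v ≟ sink | R v
  ... | yes v≡ | _ = contradiction v≡ v≢
  hop-arc R v≢ refl | no _ | just _ = refl

  module _ {R : Sel n} {L : Pred (Fin n) 0ℓ} where

    reach-mono : ∀ {k l v} → k ≤ l → Reach R L k v → Reach R L l v
    reach-mono (s≤s k≤l) (done l)        = done l
    reach-mono (s≤s k≤l) (via v≢ arc r)  = via v≢ arc (reach-mono k≤l r)

    reach-map : ∀ {L′ : Pred (Fin n) 0ℓ} → (∀ {v} → L v → L′ v) → ∀ {k v} → Reach R L k v → Reach R L′ k v
    reach-map f (done l)        = done (f l)
    reach-map f (via v≢ arc r)  = via v≢ arc (reach-map f r)

    -- Induction along the activation order: arcs lead into `L` or back to earlier nodes of `S`, so
    -- walks descend until they meet `L` or the base, and the number of activations bounds their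
    -- length.
    reach-steps : {Q : List (Fin n) → Pred (Fin n) 0ℓ} {S : Pred (Fin n) 0ℓ} → ∀ {ρ σ} →
      Steps Q ρ σ → (∀ {v} → v ∈ sink ∷ ρ → S v → Reach R L (suc (length ρ)) v) →
      (∀ {v θ} → Suffix ρ θ → Suffix (v ∷ θ) σ → v ∉ θ → Q θ v → S v →
         v ≢ sink × ∃[ w ] (R v ≡ just w × (L w ⊎ w ∈ sink ∷ θ × S w))) →
      ∀ {v} → v ∈ sink ∷ σ → S v → Reach R L (suc (length σ)) v
    reach-steps [] base arc v∈ sv = base v∈ sv
    reach-steps (step s v∉ q) base arc (there (here refl)) sv with arc (steps-suffix s) here v∉ q sv
    ... | v≢ , w , eq , inj₁ l = via v≢ eq (done l)
    ... | v≢ , w , eq , inj₂ (w∈ , sw) =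
      via v≢ eq (reach-steps s base (λ ρθ θσ → arc ρθ (there θσ)) w∈ sw)
    reach-steps (step s v∉ q) base arc (here refl) sv =
      reach-mono (n≤1+n _) (reach-steps s base (λ ρθ θσ → arc ρθ (there θσ)) (here refl) sv)
    reach-steps (step s v∉ q) base arc (there (there v∈)) sv =
      reach-mono (n≤1+n _) (reach-steps s base (λ ρθ θσ → arc ρθ (there θσ)) (there v∈) sv)

    hops-closed : (∀ {v} → L v → L (hop N R v)) → ∀ k {v} → L v → L (hops N R k v)
    hops-closed closed zero    l = l
    hops-closed closed (suc k) l = hops-closed closed k (closed l)

    reach⇒hops : (∀ {v} → L v → L (hop N R v)) → ∀ k {v} → Reach R L k v → L (hops N R k v)
    reach⇒hops closed (suc k) (done l)      = hops-closed closed (suc k) l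
    reach⇒hops closed (suc k) (via v≢ eq r) =
      subst (L ∘ hops N R k) (sym (hop-arc R v≢ eq)) (reach⇒hops closed k r)

  -- A node has at most one arc in `R`, so a walk from `B` is forced to stay in `B`, which omits the
  -- sink.
  trapped : ∀ {R} {B : Pred (Fin n) 0ℓ} → (∀ {v} → B v → v ≢ sink × ∃[ w ] (R v ≡ just w × B w)) →
    ∀ {k v} → B v → ¬ Reach R AtSink k v
  trapped closed b (done v≡) = proj₁ (closed b) v≡
  trapped {R} {B} closed b (via _ eq r) with closed b
  ... | _ , w , eq′ , bw = trapped closed (subst B (just-injective (trans (sym eq′) eq)) bw) r

  -- The protocol carries out abstract executions

  module _ (D : Fin n → List (Fin n)) where

    pathIn⇒reach : ∀ {R} k {v p} → pathIn N D R k v ≡ just p → Reach R AtSink k v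
    pathIn⇒reach {R} (suc k) {v} eq with v ≟ sink | R v in arc
    ... | yes v≡ | _ = done v≡
    ... | no v≢ | just w with pathIn N D R k w in eq′
    ...   | just _ = via v≢ arc (pathIn⇒reach k eq′)

    reach⇒pathIn : ∀ {R k v} → Reach R AtSink k v → ∃[ p ] pathIn N D R k v ≡ just p
    reach⇒pathIn {R} {suc k} {v} r with v ≟ sink | r
    ... | yes _  | _       = _ , refl
    ... | no v≢  | done v≡ = contradiction v≡ v≢
    ... | no _   | via {w = w} _ eq r′ rewrite eq with pathIn N D R k w | reach⇒pathIn r′
    ...   | _ | _ , refl = _ , refl

    clear⇒reach : ∀ {R v} → Clear (pathIn N D R n) v → Reach R AtSink n v
    clear⇒reach {R} {v} (_ , eq) with v ≟ sink
    ... | no _     = pathIn⇒reach n eq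
    -- `eff` makes the sink clear whatever `pathIn` returns; the fuel `n` is positive because a node
    -- exists.
    ... | yes refl = reach-mono (n>0 v) (done {k = 0} refl)
      where
      n>0 : ∀ {m} → Fin m → 1 ≤ m
      n>0 zero    = s≤s z≤n
      n>0 (suc _) = s≤s z≤n

    reach⇒clear : ∀ {R v} → Reach R AtSink n v → Clear (pathIn N D R n) v
    reach⇒clear {R} {v} r with v ≟ sink
    ... | yes _ = _ , refl
    ... | no _  = reach⇒pathIn r

    module _ (unfiltered : ∀ v → D v ≡ []) where

      nofilter : ∀ p → any (λ x → elem N x []) p ≡ false
      nofilter []      = refl
      nofilter (_ ∷ p) = nofilter p

      best-computes : ∀ {P v ws w} → Best (Clear P) ws w → ∃[ p ] best N D P v ws ≡ just (w , p)
      best-computes {P} {v} {w ∷ ws} (here (p , eq)) with eff N P w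
      best-computes {v = v} (here (p , refl)) | just p rewrite unfiltered v | nofilter p = p , refl
      best-computes {P} {v} {x ∷ ws} (there ¬k b) with eff N P x
      ... | nothing = best-computes b
      ... | just p  = contradiction (p , refl) ¬k

      activate-best : ∀ {s P v w} → Best (Clear P) (pref v) w →
        ∃[ p ] activate N D (config s P) v ≡ config (upd N s v (just w)) (upd N P v (just p))
      activate-best {s} {P} {v} b with best N D P v (pref v) | best-computes {P} {v} b
      ... | _ | p , refl = v ∷ p , refl

      upd-same : ∀ {A : Set} (f : Fin n → A) v {a} → upd N f v a v ≡ a
      upd-same f v with v ≟ v
      ... | yes _ = refl
      ... | no ≢  = contradiction refl ≢

      upd-other : ∀ {A : Set} (f : Fin n → A) {v a u} → u ≢ v → upd N f v a u ≡ f u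
      upd-other f {v} {u = u} u≢ with u ≟ v
      ... | yes u≡ = contradiction u≡ u≢
      ... | no _   = refl

      clear-upd⁺ : ∀ {P v p u} → Clear P u ⊎ u ≡ v → Clear (upd N P v (just p)) u
      clear-upd⁺ {v = v} {u = u} c with u ≟ sink | u ≟ v
      ... | yes _ | _      = _ , refl
      ... | no _  | yes _  = _ , refl
      ... | no _  | no u≢  = [ id , (λ u≡ → contradiction u≡ u≢) ]′ c

      clear-upd⁻ : ∀ {P v p u} → Clear (upd N P v (just p)) u → Clear P u ⊎ u ≡ v
      clear-upd⁻ {v = v} {u = u} c with u ≟ sink | u ≟ v
      ... | yes _ | _      = inj₁ (_ , refl)
      ... | no _  | yes u≡ = inj₂ u≡
      ... | no _  | no _   = inj₁ c

      controlPlane-∷ʳ : ∀ c π v →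
        controlPlane N D c (π ++ v ∷ []) ≡ activate N D (controlPlane N D c π) v
      controlPlane-∷ʳ c []      v = refl
      controlPlane-∷ʳ c (u ∷ π) v = controlPlane-∷ʳ (activate N D c u) π v

      -- Without filters, choices depend on paths only through which nodes are clear, so clear sets
      -- and selected arcs are all that is tracked.
      record Executed (C : Pred (Fin n) 0ℓ) (ρ : List (Fin n)) (d : Config n) : Set where
        constructor executed
        field
          clear⁻   : ∀ u → Clear (Config.paths d) u → K C ρ u
          clear⁺   : ∀ u → K C ρ u → Clear (Config.paths d) u
          realizes : Realizes C ρ (Config.sel d)

      executed-step : ∀ {C ρ d v w} → Executed C ρ d → v ∉ ρ → Best (K C ρ) (pref v) w →
        Executed C (v ∷ ρ) (activate N D d v)
      executed-step {C} {ρ} {config s P} {v} {w} (executed clear⁻ clear⁺ realizes) v∉ b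
        with activate N D (config s P) v
           | activate-best {s} (best-restrict clear⁻ b (clear⁺ _ (best-holds b)))
      ... | _ | p , refl = executed ⇒ ⇐ realizes′
        where
        ⇒ : ∀ u → Clear (upd N P v (just p)) u → K C (v ∷ ρ) u
        ⇒ u c with clear-upd⁻ {P} c
        ... | inj₂ u≡ = inj₂ (here u≡)
        ... | inj₁ c′ with clear⁻ u c′
        ...   | inj₁ cu = inj₁ cu
        ...   | inj₂ u∈ = inj₂ (there u∈)

        ⇐ : ∀ u → K C (v ∷ ρ) u → Clear (upd N P v (just p)) u
        ⇐ u (inj₁ cu)         = clear-upd⁺ {P} {u = u} (inj₁ (clear⁺ u (inj₁ cu)))
        ⇐ u (inj₂ (here u≡))  = clear-upd⁺ {P} (inj₂ u≡)
        ⇐ u (inj₂ (there u∈)) = clear-upd⁺ {P} {u = u} (inj₁ (clear⁺ u (inj₂ u∈)))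

        realizes′ : Realizes C (v ∷ ρ) (upd N s v (just w))
        realizes′ here = w , upd-same s v , b
        realizes′ (there θσ) with realizes θσ
        ... | w′ , eq , b′ =
          w′ , trans (upd-other s λ { refl → v∉ (suffix-∈ θσ (here refl)) }) eq , b′

      exec-executed : ∀ c {ρ} → Exec (Clear (Config.paths c)) ρ →
        Executed (Clear (Config.paths c)) ρ (controlPlane N D c (reverse ρ))
      exec-executed c [] = executed (λ _ → inj₁) (λ { _ (inj₁ cu) → cu }) λ ()
      exec-executed c {v ∷ ρ} (step s v∉ (_ , _ , b , _))
        rewrite unfold-reverse v ρ | controlPlane-∷ʳ c (reverse ρ) v =
        executed-step (exec-executed c s) v∉ b

  -- First choices and complete orders

  First : Fin n → Fin n → Set
  First v = Best U (pref v)

  first-exists : ∀ {v} → v ≢ sink → ∃[ w ] First v w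
  first-exists {v} v≢ with reach v
  ... | atSink     = contradiction refl v≢
  ... | viaArc w∈ _ = best-exists (λ _ → yes tt) w∈ tt

  best-first : ∀ {C : Pred (Fin n) 0ℓ} {v w} → First v w → C w → Best C (pref v) w
  best-first = best-restrict (λ _ _ → tt)

  -- All chosen arcs point to the sink or to nodes that moved earlier, so such moves build a tree
  -- directed to the sink.
  Rooted : Pred (Fin n) 0ℓ → List (Fin n) → Pred (Fin n) 0ℓ
  Rooted C ρ v = v ≢ sink × ∃[ w ] (Best (K C ρ) (pref v) w × w ∈ sink ∷ ρ)

  realizes-best : ∀ {C ρ R v θ w} → Realizes C ρ R → Suffix (v ∷ θ) ρ →
    Best (K C θ) (pref v) w → R v ≡ just w
  realizes-best real θρ b with real θρ
  ... | w′ , eq , b′ = trans eq (cong just (best-cross b′ b (best-holds b) (best-holds b′)))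

  rooted-reach : ∀ {C ρ σ R v} → Steps (Rooted C) [] σ → Suffix σ ρ → Realizes C ρ R →
    v ∈ sink ∷ σ → Reach R AtSink (suc (length σ)) v
  rooted-reach {R = R} s σρ real v∈ = reach-steps {S = U} s
    (λ { (here refl) _ → done refl })
    (λ { _ θσ _ (v≢ , w , b , w∈) _ →
       v≢ , w , realizes-best {R = R} real (suffix-trans θσ σρ) b , inj₂ (w∈ , tt) })
    v∈ tt

  K? : ∀ {C} → Decidable C → ∀ ρ → Decidable (K C ρ)
  K? C? ρ u = C? u ⊎-dec (u ∈? ρ)

  move? : ∀ {C P} → Decidable C → Decidable P → ∀ ρ → Decidable (Move C P ρ)
  move? C? P? ρ v = ¬? (v ≟ sink) ×-dec best-dec (K? C? ρ) P? (pref v)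

  exec-sink : ∀ {C ρ} → Exec C ρ → sink ∉ ρ
  exec-sink (step s _ (v≢ , _)) (here sink≡) = v≢ (sym sink≡)
  exec-sink (step s _ _)        (there sink∈) = exec-sink s sink∈

  exec-bound : ∀ {C ρ} → Exec C ρ → suc (length ρ) ≤ n
  exec-bound s = unique⇒length≤ (unique-∷ (exec-sink s) (steps-unique s []))

  Stuck : Pred (Fin n) 0ℓ → List (Fin n) → Set
  Stuck C ρ = ∀ v → v ∉ ρ → ¬ Move C U ρ v

  -- Induction along a path to the sink: an unclear node with a clear out-neighbour could still
  -- move. Only moves of initially unclear nodes are excluded, so this applies at the end of phase B
  -- already.
  stuck-clear : ∀ {C ρ} → Decidable C → C sink →
    (∀ v → v ∉ ρ → ¬ (¬ C v × Move C U ρ v)) → ∀ v → K C ρ v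
  stuck-clear {C} {ρ} C? csink stuck v = go (reach v)
    where
    go : ∀ {v} → ReachesSink sink pref v → K C ρ v
    go atSink = inj₁ csink
    go {v} (viaArc w∈ r) with K? C? ρ v
    ... | yes k = k
    ... | no ¬k with best-exists (K? C? ρ) w∈ (go r)
    ...   | w , b = contradiction
      (¬k ∘ inj₁ , (λ { refl → ¬k (inj₁ csink) }) , w , b , tt) (stuck v (¬k ∘ inj₂))

  stuck-complete : ∀ {C ρ} → Decidable C → C sink → Stuck C ρ → ∀ v → v ∈ sink ∷ ρ
  stuck-complete {C} {ρ} C? csink stuck v with v ∈? (sink ∷ ρ)
  ... | yes v∈ = v∈
  ... | no v∉ with first-exists (v∉ ∘ here)
  ...   | w , f = contradiction (v∉ ∘ here , w , best-first f (clear w) , tt) (stuck v (v∉ ∘ there))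
    where
    clear : ∀ v → K C ρ v
    clear = stuck-clear C? csink λ u u∉ → stuck u u∉ ∘ proj₂

  exec-order : ∀ {C ρ} → Decidable C → C sink → Exec C ρ → Stuck C ρ → IsOrder N (reverse ρ)
  exec-order {ρ = ρ} C? csink s stuck =
    unique-reverse (steps-unique s []) , exec-sink s ∘ Any.reverse⁻ , complete
    where
    complete : ∀ v → v ≢ sink → v ∈ reverse ρ
    complete v v≢ with stuck-complete C? csink stuck v
    ... | here v≡  = contradiction v≡ v≢
    ... | there v∈ = Any.reverse⁺ v∈

  -- The core of nodes reaching the sink by first choices

  First∈ : List (Fin n) → Pred (Fin n) 0ℓ
  First∈ ρ v = v ≢ sink × ∃[ w ] (First v w × w ∈ sink ∷ ρ)

  -- sink ∷ τ consists of the nodes that reach the sink by first choices.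
  module Core (τ : List (Fin n)) (grow : Steps First∈ [] τ)
              (closed : ∀ v → v ∉ τ → ¬ First∈ τ v) where

    InT : Pred (Fin n) 0ℓ
    InT u = u ∈ sink ∷ τ

    inT? : Decidable InT
    inT? u = u ∈? (sink ∷ τ)

    first-outside : ∀ {v w} → ¬ InT v → First v w → ¬ InT w
    first-outside ¬t f w∈ = closed _ (¬t ∘ there) (¬t ∘ here , _ , f , w∈)

    -- In the order in which `τ` grew, the first choice of each node is clear at its turn, whatever
    -- else `C` contains.
    core-rooted : ∀ {C} → C sink → Steps (Rooted C) [] τ
    core-rooted {C} csink = steps-map
      (λ { (v≢ , w , f , w∈) → v≢ , w , best-first f (sink∷⊆K {C} csink w∈) , w∈ }) grow

    core-exec : ∀ {C} → C sink → Exec C τ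
    core-exec csink = steps-map (λ { (v≢ , w , b , _) → v≢ , w , b , tt }) (core-rooted csink)

    core-⊆K : ∀ {C θ} → C sink → Suffix τ θ → ∀ {u} → InT u → K C θ u
    core-⊆K csink τθ (here refl) = inj₁ csink
    core-⊆K csink τθ (there u∈)  = inj₂ (suffix-∈ τθ u∈)

    -- The order that feeds traps first

    module _ {C : Pred (Fin n) 0ℓ} (C? : Decidable C) (csink : C sink) where

      Waiting : List (Fin n) → Pred (Fin n) 0ℓ
      Waiting ρ v = ¬ C v × Move C U ρ v

      -- In phase A no chosen arc enters the core, so phase A can only feed traps. Every node x left
      -- over has best clear choice in the core, whence first x is still unclear (Opened) itself.
      record BadFirst : Set where
        field
          ρA ρB ρC : List (Fin n)
          stepsA : Steps (Move C (¬_ ∘ InT)) τ ρA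
          stuckA : ∀ v → v ∉ ρA → ¬ Move C (¬_ ∘ InT) ρA v
          stepsB : Steps Waiting ρA ρB
          stuckB : ∀ v → v ∉ ρB → ¬ Waiting ρB v
          stepsC : Steps (Move C U) ρB ρC
          stuckC : Stuck C ρC

        exec : Exec C ρC
        exec = steps-trans (core-exec csink)
          (steps-trans (steps-map (λ { (v≢ , w , b , _) → v≢ , w , b , tt }) stepsA)
          (steps-trans (steps-map proj₂ stepsB) stepsC))

        -- These nodes move in phase B and all reach the sink.
        Opened : Pred (Fin n) 0ℓ
        Opened x = x ∉ ρA × ¬ C x

        τ⊆ρA : Suffix τ ρA
        τ⊆ρA = steps-suffix stepsA

        ρB⊆ρC : Suffix ρB ρC
        ρB⊆ρC = steps-suffix stepsC

        ρA⊆ρC : Suffix ρA ρC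
        ρA⊆ρC = suffix-trans (steps-suffix stepsB) ρB⊆ρC

        opened-outside : ∀ {x} → Opened x → ¬ InT x
        opened-outside (x∉ , ¬c) (here refl) = ¬c csink
        opened-outside (x∉ , ¬c) (there x∈)  = x∉ (suffix-∈ τ⊆ρA x∈)

        unpreferred : ∀ {x w} → x ∉ ρA → ¬ InT x → Best (K C ρA) (pref x) w → InT w
        unpreferred x∉ ¬t b = decidable-stable (inT? _)
          λ ¬tw → stuckA _ x∉ (¬t ∘ here , _ , b , ¬tw)

        opened-first : ∀ {x w} → x ∉ ρA → ¬ InT x → First x w → Opened w
        opened-first x∉ ¬t f = (λ w∈ → ¬k (inj₂ w∈)) , λ c → ¬k (inj₁ c)
          where
          ¬k : ¬ K C ρA _
          ¬k k = first-outside ¬t f (unpreferred x∉ ¬t (best-first f k))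

        -- A choice clear after phase A lies in the core because phase A is exhausted; any other
        -- choice became clear by moving later, hence is opened itself.
        opened-best : ∀ {x w θ} → Suffix ρA θ → Opened x → Best (K C θ) (pref x) w →
          w ∈ sink ∷ θ × (InT w ⊎ Opened w)
        opened-best {x} {w} ρAθ o b with K? C? ρA w
        ... | yes k with unpreferred (proj₁ o) (opened-outside o) (best-restrict widen b k)
          where
          widen : ∀ u → K C ρA u → K C _ u
          widen u (inj₁ c)  = inj₁ c
          widen u (inj₂ u∈) = inj₂ (suffix-∈ ρAθ u∈)
        ...   | here w≡  = here w≡ , inj₁ (here w≡)
        ...   | there w∈ = there (suffix-∈ (suffix-trans τ⊆ρA ρAθ) w∈) , inj₁ (there w∈)
        opened-best ρAθ o b | no ¬k with best-holds b
        ...   | inj₁ c  = contradiction (inj₁ c) ¬k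
        ...   | inj₂ w∈ = there w∈ , inj₂ ((λ w∈A → ¬k (inj₂ w∈A)) , λ c → ¬k (inj₁ c))

        opened-∈ : ∀ {x} → Opened x → x ∈ ρB
        opened-∈ {x} (_ , ¬c) = [ (λ c → contradiction c ¬c) , id ]′ (stuck-clear C? csink stuckB x)

        module _ {R : Sel n} (real : Realizes C ρC R) where

          good-reach : ∀ {v} → InT v ⊎ Opened v → Reach R AtSink n v
          good-reach {v} g = reach-mono bound
            (reach-steps {S = λ u → InT u ⊎ Opened u} stepsB base arc (v∈ g) g)
            where
            bound : suc (length ρB) ≤ n
            bound = unique⇒length≤ (unique-∷ (exec-sink exec ∘ suffix-∈ ρB⊆ρC)
              (steps-unique stepsB (steps-unique stepsA (steps-unique grow []))))

            v∈ : ∀ {v} → InT v ⊎ Opened v → v ∈ sink ∷ ρB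
            v∈ (inj₁ (here v≡))  = here v≡
            v∈ (inj₁ (there v∈)) = there (suffix-∈ (suffix-trans τ⊆ρA (steps-suffix stepsB)) v∈)
            v∈ (inj₂ o)          = there (opened-∈ o)

            inT-reach : ∀ {v} → InT v → Reach R AtSink (suc (length ρA)) v
            inT-reach t = reach-mono (s≤s (suffix-length τ⊆ρA))
              (rooted-reach (core-rooted csink) (suffix-trans τ⊆ρA ρA⊆ρC) real t)

            base : ∀ {v} → v ∈ sink ∷ ρA → InT v ⊎ Opened v → Reach R AtSink (suc (length ρA)) v
            base _           (inj₁ t)         = inT-reach t
            base (here refl) (inj₂ _)         = done refl
            base (there v∈)  (inj₂ (v∉ , _))  = contradiction v∈ v∉

            arc : ∀ {v θ} → Suffix ρA θ → Suffix (v ∷ θ) ρB → v ∉ θ → Waiting θ v →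
              InT v ⊎ Opened v →
              v ≢ sink × ∃[ w ] (R v ≡ just w × (w ≡ sink ⊎ w ∈ sink ∷ θ × (InT w ⊎ Opened w)))
            arc ρAθ θρB v∉ (¬c , v≢ , w , b , _) _ =
              v≢ , w , realizes-best {R = R} real (suffix-trans θρB ρB⊆ρC) b ,
              inj₂ (opened-best ρAθ (v∉ ∘ suffix-∈ ρAθ , ¬c) b)

          -- Clear nodes after the round

          module Next {C′ : Pred (Fin n) 0ℓ} (C′? : Decidable C′)
                      (clear⇒ : ∀ {v} → C′ v → Reach R AtSink n v)
                      (clear⇐ : ∀ {v} → Reach R AtSink n v → C′ v) where

            -- A node that did not move in phase A has an opened first choice, which is now clear. A
            -- node that moved then chose `w` outside the core, and `w` is clear because the path of
            -- `x` runs through it; a best choice in the core was available at that turn too and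
            -- would have beaten `w`.
            avoids-core : ∀ x → C′ x → ¬ InT x → ∃[ w ] (Best C′ (pref x) w × ¬ InT w)
            avoids-core x c′ ¬t with x ∈? ρA | first-exists (¬t ∘ here)
            ... | no x∉ | w , f =
              w , best-first f (clear⇐ (good-reach (inj₂ (opened-first x∉ ¬t f)))) , first-outside ¬t f
            ... | yes x∈ | _ with steps-∈ stepsA x∈
            ...   | inj₁ x∈τ = contradiction (there x∈τ) ¬t
            ...   | inj₂ (θ , τθ , θρ , _ , x≢ , w , b , ¬tw) = w′ , b′ , ¬tw′
              where
              arc : R x ≡ just w
              arc = realizes-best {R = R} real (suffix-trans θρ ρA⊆ρC) b

              reach-next : ∀ {k} → Reach R AtSink k x → Reach R AtSink k w
              reach-next (done x≡) = contradiction x≡ x≢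
              reach-next (via _ eq r) with trans (sym arc) eq
              ... | refl = reach-mono (n≤1+n _) r

              c′w : C′ w
              c′w = clear⇐ (reach-next (clear⇒ c′))

              w′ = proj₁ (best-exists C′? (best-∈ b) c′w)
              b′ = proj₂ (best-exists C′? (best-∈ b) c′w)

              ¬tw′ : ¬ InT w′
              ¬tw′ t = ¬tw (subst InT (sym (best-cross b b′ (core-⊆K {C} csink τθ t) c′w)) t)

            -- If the clear nodes outside the core prefer each other to the core, then phase A moves
            -- all of them, and it ends up without any path to the sink.
            module Settled (T⊆C : ∀ {v} → InT v → C v)
                           (avoid : ∀ x → C x → ¬ InT x → ∃[ w ] (Best C (pref x) w × ¬ InT w)) where

              -- If `x` missed phase A, its best choice afterwards would lie in the core. The core
              -- is clear from the start, so this would also be the best choice in `C`, against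
              -- `avoid`.
              clear-∈ : ∀ {x} → C x → ¬ InT x → x ∈ ρA
              clear-∈ {x} c ¬t with x ∈? ρA | avoid x c ¬t
              ... | yes x∈ | _ = x∈
              ... | no x∉ | w , b , ¬tw with best-exists (K? C? ρA) (best-∈ b) (inj₁ (best-holds b))
              ...   | w′ , b′ with unpreferred x∉ ¬t b′
              ...     | tw′ = contradiction
                (subst InT (best-cross b′ b (inj₁ (best-holds b)) (T⊆C tw′)) tw′) ¬tw

              Bad : Pred (Fin n) 0ℓ
              Bad v = v ∈ ρA × ¬ InT v

              -- The target either was clear before the round, and then `clear-∈` applies to it, or
              -- has moved earlier in phase A.
              bad-closed : ∀ {v} → Bad v → v ≢ sink × ∃[ w ] (R v ≡ just w × Bad w)
              bad-closed (v∈ , ¬t) with steps-∈ stepsA v∈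
              ... | inj₁ v∈τ = contradiction (there v∈τ) ¬t
              ... | inj₂ (θ , _ , θρ , _ , v≢ , w , b , ¬tw) =
                v≢ , w ,
                realizes-best {R = R} real (suffix-trans θρ ρA⊆ρC) b ,
                [ (λ c → clear-∈ c ¬tw) , suffix-∈ (suffix-tail θρ) ]′ (best-holds b) , ¬tw

              clear-good : ∀ {v} → C′ v → InT v ⊎ Opened v
              clear-good {v} c′ with inT? v | v ∈? ρA
              ... | yes t | _      = inj₁ t
              ... | no ¬t | yes v∈ = contradiction (clear⇒ c′) (trapped bad-closed (v∈ , ¬t))
              ... | no ¬t | no v∉  = inj₂ (v∉ , λ c → v∉ (clear-∈ c ¬t))

              module _ {C″ : Pred (Fin n) 0ℓ} (sink″ : C″ sink) (disjoint : ∀ {v} → C″ v → ¬ Opened v) where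

                -- The opened nodes repeat their moves as long as the rest of them are unclear.
                reopen : ∀ {σ} → Steps Waiting ρA σ →
                  ∃[ ω ] (Steps (Rooted C″) τ ω × (∀ {u} → u ∈ ω → u ∈ σ) ×
                          (∀ {u} → u ∈ σ → Opened u → u ∈ ω))
                reopen [] = τ , [] , suffix-∈ τ⊆ρA , λ u∈ o → contradiction u∈ (proj₁ o)
                reopen {v ∷ σ} (step s v∉ (¬c , v≢ , w , b , _)) with reopen s
                ... | ω , s′ , ω⊆ , ⊆ω =
                  v ∷ ω , step s′ (v∉ ∘ ω⊆) (v≢ , w , best-restrict narrow b (sink∷⊆K {C″} sink″ w∈) , w∈) , ⊆′ , ⊇′
                  where
                  -- A node that is not opened was available at the end of phase A, so `C″` offers
                  -- no option that was missing in phase B, and the old best choice stays best.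
                  narrow : ∀ u → K C″ ω u → K C σ u
                  narrow u (inj₂ u∈) = inj₂ (ω⊆ u∈)
                  narrow u (inj₁ c″) with C? u | u ∈? ρA
                  ... | yes c | _      = inj₁ c
                  ... | no _  | yes u∈ = inj₂ (suffix-∈ (steps-suffix s) u∈)
                  ... | no ¬c | no u∉  = contradiction (u∉ , ¬c) (disjoint c″)

                  -- The old choice is in the core or is an opened node that moved earlier and has
                  -- moved again by now.
                  w∈ : w ∈ sink ∷ ω
                  w∈ with opened-best (steps-suffix s) (v∉ ∘ suffix-∈ (steps-suffix s) , ¬c) b
                  ... | here w≡  , _              = here w≡
                  ... | there _  , inj₁ (here w≡) = here w≡
                  ... | there _  , inj₁ (there t) = there (suffix-∈ (steps-suffix s′) t)
                  ... | there w∈ , inj₂ o         = there (⊆ω w∈ o)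

                  ⊆′ : ∀ {u} → u ∈ v ∷ ω → u ∈ v ∷ σ
                  ⊆′ (here u≡)  = here u≡
                  ⊆′ (there u∈) = there (ω⊆ u∈)

                  ⊇′ : ∀ {u} → u ∈ v ∷ σ → Opened u → u ∈ v ∷ ω
                  ⊇′ (here u≡)  _ = here u≡
                  ⊇′ (there u∈) o = there (⊆ω u∈ o)

      bad-first : BadFirst
      bad-first with saturate (move? C? (¬? ∘ inT?)) (steps-unique grow [])
      ... | ρA , stepsA , stuckA with steps-unique stepsA (steps-unique grow [])
      ... | uA with saturate (λ ρ v → ¬? (C? v) ×-dec move? C? (λ _ → yes tt) ρ v) uA
      ... | ρB , stepsB , stuckB with saturate (move? C? λ _ → yes tt) (steps-unique stepsB uA)
      ... | ρC , stepsC , stuckC = record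
        { stepsA = stepsA ; stuckA = stuckA ; stepsB = stepsB ; stuckB = stuckB
        ; stepsC = stepsC ; stuckC = stuckC }

      -- Trapping the opened nodes

      -- If only the core and a set O closed under first choices are clear, then O moves along first
      -- choices and becomes a trap, and every other node is routed to the core or into this trap.
      module Trap {O : Pred (Fin n) 0ℓ} (C⊆ : ∀ {v} → C v → InT v ⊎ O v) (O⊆C : ∀ {v} → O v → C v)
                  (outside : ∀ {v} → O v → ¬ InT v)
                  (first-closed : ∀ {v w} → O v → First v w → O w)
                  {ρ : List (Fin n)} (steps : Steps (Move C U) τ ρ) (stuck : Stuck C ρ)
                  {R : Sel n} (real : Realizes C ρ R) where

        exec-from-core : Exec C ρ
        exec-from-core = steps-trans (core-exec csink) steps

        O-closed : ∀ {v} → O v → v ≢ sink × ∃[ w ] (R v ≡ just w × O w)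
        O-closed {v} o with stuck-complete C? csink stuck v
        ... | here v≡ = contradiction (here v≡) (outside o)
        ... | there v∈ with suffix-∈⁻ v∈ | first-exists (outside o ∘ here)
        ...   | θ , θρ | w , f =
          outside o ∘ here , w ,
          realizes-best {R = R} real θρ (best-first f (inj₁ (O⊆C (first-closed o f)))) , first-closed o f

        O-hop : ∀ {v} → O v → O (hop N R v)
        O-hop o with O-closed o
        ... | v≢ , w , eq , ow = subst O (sym (hop-arc R v≢ eq)) ow

        Landed : Pred (Fin n) 0ℓ
        Landed v = v ≡ sink ⊎ O v

        landed-closed : ∀ {v} → Landed v → Landed (hop N R v)
        landed-closed (inj₁ v≡) = inj₁ (trans (hop-sink R v≡) v≡)
        landed-closed (inj₂ o)  = inj₂ (O-hop o)

        -- A choice either moved earlier in this round or was clear before it, and then it is in `O`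
        -- or in the core, which moves first. So walks descend to the sink or into `O`.
        lands : ∀ v → Landed (forward N R v)
        lands v = reach⇒hops {L = Landed} landed-closed n (reach-mono (exec-bound exec-from-core)
          (reach-steps {S = U} steps base arc (stuck-complete C? csink stuck v) tt))
          where
          base : ∀ {v} → v ∈ sink ∷ τ → ⊤ → Reach R Landed (suc (length τ)) v
          base t _ = reach-map inj₁ (rooted-reach (core-rooted csink) (steps-suffix steps) real t)

          arc : ∀ {v θ} → Suffix τ θ → Suffix (v ∷ θ) ρ → v ∉ θ → Move C U θ v → ⊤ →
            v ≢ sink × ∃[ w ] (R v ≡ just w × (Landed w ⊎ w ∈ sink ∷ θ × ⊤))
          arc {θ = θ} τθ θρ _ (v≢ , w , b , _) _ =
            v≢ , w , realizes-best {R = R} real θρ b , target (best-holds b)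
            where
            target : K C θ w → Landed w ⊎ w ∈ sink ∷ θ × ⊤
            target (inj₂ w∈) = inj₂ (there w∈ , tt)
            target (inj₁ c) with C⊆ c
            ... | inj₁ (here w≡) = inj₁ (inj₁ w≡)
            ... | inj₁ (there t) = inj₂ (there (suffix-∈ τθ t) , tt)
            ... | inj₂ o         = inj₁ (inj₂ o)

        mates-trapped : ∀ {x y} → O x → CycleMate N R x y → O y
        mates-trapped o (k , eq , _) = subst O eq (hops-closed {L = O} O-hop k o)

    -- The four rounds

    module Rounds (D : Fin n → List (Fin n)) (unfiltered : ∀ v → D v ≡ []) where

      ClearIn : Config n → Pred (Fin n) 0ℓ
      ClearIn d = Clear (Config.paths d)

      clearIn? : ∀ d → Decidable (ClearIn d)
      clearIn? d = clear? (Config.paths d)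

      clearIn-sink : ∀ d → ClearIn d sink
      clearIn-sink d = clear-sink (Config.paths d)

      graph : Config n → List (Fin n) → Sel n
      graph d ρ = Config.sel (controlPlane N D d (reverse ρ))

      next : Config n → List (Fin n) → Config n
      next d ρ = config (graph d ρ) (pathIn N D (graph d ρ) n)

      realizes : ∀ d {ρ} → Exec (ClearIn d) ρ → Realizes (ClearIn d) ρ (graph d ρ)
      realizes d s = Executed.realizes (exec-executed D unfiltered d s)

      complete : ∀ d {ρ} → Unique ρ → ∃[ σ ] (Steps (Move (ClearIn d) U) ρ σ × Stuck (ClearIn d) σ)
      complete d = saturate (move? (clearIn? d) λ _ → yes tt)

      clear-next⇒ : ∀ c ρ {v} → ClearIn (next c ρ) v → Reach (graph c ρ) AtSink n v
      clear-next⇒ c ρ = clear⇒reach D {R = graph c ρ}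

      clear-next⇐ : ∀ c ρ {v} → Reach (graph c ρ) AtSink n v → ClearIn (next c ρ) v
      clear-next⇐ c ρ = reach⇒clear D {R = graph c ρ}

      CoreClear AvoidsCore : Config n → Set
      CoreClear d  = ∀ {v} → InT v → ClearIn d v
      AvoidsCore d = ∀ x → ClearIn d x → ¬ InT x → ∃[ w ] (Best (ClearIn d) (pref x) w × ¬ InT w)

      first-round : ∀ c → ∃[ ρ ] (IsOrder N (reverse ρ) × CoreClear (next c ρ) × AvoidsCore (next c ρ))
      first-round c with bad-first (clearIn? c) (clearIn-sink c)
      ... | bf =
        B.ρC , exec-order (clearIn? c) (clearIn-sink c) B.exec B.stuckC ,
        (λ t → clear-next⇐ c B.ρC (B.good-reach {graph c B.ρC} real (inj₁ t))) ,
        B.Next.avoids-core {graph c B.ρC} real {ClearIn (next c B.ρC)} (clearIn? (next c B.ρC))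
          (clear-next⇒ c B.ρC) (clear-next⇐ c B.ρC)
        where
        module B = BadFirst bf
        real : Realizes (ClearIn c) B.ρC (graph c B.ρC)
        real = realizes c B.exec

      -- What rounds 3 and 4 need to know of round 2. `reopen` covers all clear sets `C″` because it
      -- is applied to the one left by round 3.
      record Openable (O C : Pred (Fin n) 0ℓ) : Set₁ where
        field
          clear-good   : ∀ {v} → C v → InT v ⊎ O v
          clear        : ∀ {v} → O v → C v
          outside      : ∀ {v} → O v → ¬ InT v
          first-closed : ∀ {v w} → O v → First v w → O w
          reopen       : ∀ {C″ : Pred (Fin n) 0ℓ} → C″ sink → (∀ {v} → C″ v → ¬ O v) →
                         ∃[ ω ] (Steps (Rooted C″) τ ω × (∀ {v} → O v → v ∈ ω))

      second-round : ∀ c → CoreClear c → AvoidsCore c →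
        ∃[ ρ ] (IsOrder N (reverse ρ) × ∃[ O ] Openable O (ClearIn (next c ρ)))
      second-round c coreClear avoids with bad-first (clearIn? c) (clearIn-sink c)
      ... | bf =
        B.ρC , exec-order (clearIn? c) (clearIn-sink c) B.exec B.stuckC , B.Opened , record
          { clear-good   = S.clear-good
          ; clear        = λ o → clear-next⇐ c B.ρC (B.good-reach {graph c B.ρC} real (inj₂ o))
          ; outside      = B.opened-outside
          ; first-closed = λ o → B.opened-first (proj₁ o) (B.opened-outside o)
          ; reopen       = reopen
          }
        where
        module B = BadFirst bf
        real : Realizes (ClearIn c) B.ρC (graph c B.ρC)
        real = realizes c B.exec
        module S = B.Next.Settled {graph c B.ρC} real {ClearIn (next c B.ρC)} (clearIn? (next c B.ρC))
                     (clear-next⇒ c B.ρC) (clear-next⇐ c B.ρC) coreClear avoids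

        reopen : ∀ {C″ : Pred (Fin n) 0ℓ} → C″ sink → (∀ {v} → C″ v → ¬ B.Opened v) →
          ∃[ ω ] (Steps (Rooted C″) τ ω × (∀ {v} → B.Opened v → v ∈ ω))
        reopen sink″ disjoint with S.reopen sink″ disjoint B.stepsB
        ... | ω , s , _ , ∈ω = ω , s , λ o → ∈ω (B.opened-∈ o) o

      third-round : ∀ c {O} → Openable O (ClearIn c) →
        ∃[ ρ ] (IsOrder N (reverse ρ) ×
                (∀ {v} → ClearIn (next c ρ) v → ¬ O v) ×
                (∀ v → forward N (graph c ρ) v ≡ sink ⊎
                       ∀ y → CycleMate N (graph c ρ) (forward N (graph c ρ) v) y → O y))
      third-round c {O} openable with complete c (steps-unique grow [])
      ... | ρ , steps , stuck =
        ρ , exec-order (clearIn? c) (clearIn-sink c) T.exec-from-core stuck ,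
        (λ cl o → trapped T.O-closed o (clear-next⇒ c ρ cl)) ,
        λ v → [ inj₁ , (λ o → inj₂ λ y → T.mates-trapped o) ]′ (T.lands v)
        where
        open Openable openable
        module T = Trap (clearIn? c) (clearIn-sink c) clear-good clear outside first-closed steps stuck
                     (realizes c (steps-trans (core-exec (clearIn-sink c)) steps))

      fourth-round : ∀ c {O C} → Openable O C → (∀ {v} → ClearIn c v → ¬ O v) →
        ∃[ ρ ] (IsOrder N (reverse ρ) × ∀ v → O v → forward N (graph c ρ) v ≡ sink)
      fourth-round c {O} openable disjoint with Openable.reopen openable (clearIn-sink c) disjoint
      -- The core moves first, then `O` as in round 2; later activations leave these arcs unchanged.
      ... | ω , reopened , ∈ω with steps-trans (core-rooted (clearIn-sink c)) reopened
      ...   | rooted with complete c (steps-unique rooted [])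
      ...     | ρ , steps , stuck =
        ρ , exec-order (clearIn? c) (clearIn-sink c) exec stuck , routes
        where
        exec : Exec (ClearIn c) ρ
        exec = steps-trans (steps-map (λ { (v≢ , w , b , _) → v≢ , w , b , tt }) rooted) steps

        routes : ∀ v → O v → forward N (graph c ρ) v ≡ sink
        routes v o = reach⇒hops {R = graph c ρ} {L = AtSink} (λ v≡ → trans (hop-sink (graph c ρ) v≡) v≡) n
          (reach-mono (≤-trans (s≤s (suffix-length (steps-suffix steps))) (exec-bound exec))
            (rooted-reach {R = graph c ρ} rooted (steps-suffix steps) (realizes c exec) (there (∈ω o))))

      -- Rounds 1 and 2 only prepare the configuration: wherever a packet stands before round 3,
      -- that round routes it or leaves all its possible positions in `O`.
      last-rounds-route : ∀ (O : Pred (Fin n) 0ℓ) {R₁ R₂ R₃ R₄ : Sel n} →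
        (∀ v → forward N R₃ v ≡ sink ⊎ ∀ y → CycleMate N R₃ (forward N R₃ v) y → O y) →
        (∀ v → O v → forward N R₄ v ≡ sink) →
        ∀ u → AlwaysRoutes N (R₁ ∷ R₂ ∷ R₃ ∷ R₄ ∷ []) u
      last-rounds-route O lands routes u = inj₂ λ y _ → inj₂ λ z _ →
        [ inj₁ , (λ mates → inj₂ λ x mate → inj₁ (routes x (mates x mate))) ]′ (lands z)

      four-rounds : ∀ c → ∃[ π₁ ] ∃[ π₂ ] ∃[ π₃ ] ∃[ π₄ ]
        (IsOrder N π₁ × IsOrder N π₂ × IsOrder N π₃ × IsOrder N π₄ ×
        (∀ u → AlwaysRoutes N (routingGraphs N D c (π₁ ∷ π₂ ∷ π₃ ∷ π₄ ∷ [])) u))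
      four-rounds c =
        case first-round c of λ { (ρ₁ , order₁ , coreClear , avoids) →
        case second-round (next c ρ₁) coreClear avoids of λ { (ρ₂ , order₂ , O , openable) →
        case third-round (next (next c ρ₁) ρ₂) openable of λ { (ρ₃ , order₃ , disjoint , lands) →
        case fourth-round (next (next (next c ρ₁) ρ₂) ρ₃) openable disjoint of λ { (ρ₄ , order₄ , routes) →
        reverse ρ₁ , reverse ρ₂ , reverse ρ₃ , reverse ρ₄ , order₁ , order₂ , order₃ , order₄ ,
        last-rounds-route O lands routes }}}}

theorem5 : ∀ {n : ℕ} (N : Network n) (D : Fin n → List (Fin n)) →
    (∀ v → D v ≡ []) →
    (c : Config n) → ValidConfig N c →
    ∃[ π₁ ] ∃[ π₂ ] ∃[ π₃ ] ∃[ π₄ ]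
    (IsOrder N π₁ × IsOrder N π₂ × IsOrder N π₃ × IsOrder N π₄ ×
    (∀ u → AlwaysRoutes N (routingGraphs N D c (π₁ ∷ π₂ ∷ π₃ ∷ π₄ ∷ [])) u))
theorem5 N D unfiltered c _ = case saturate first∈? [] of λ { (τ , grow , closed) →
  Core.Rounds.four-rounds N τ grow closed D unfiltered c }
  where
  open Network N
  first∈? : ∀ ρ → Decidable (First∈ N ρ)
  first∈? ρ v = ¬? (v ≟ sink) ×-dec best-dec (λ _ → yes tt) (_∈? (sink ∷ ρ)) (pref v)
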